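{- Let $(b(n))_{n\ge 0}=(B_0,-B_1,-B_1,B_2,B_2,-B_3,-B_3,\dots)=(1,-2,-2,6,6,-20,-20,70,70,\dots)$, i.e. $b(0)=1$ and $b(2m-1)=b(2m)=(-1)^m B_m$ for $m\ge 1$, where $B_m=\binom{2m}{m}$. Then for all integers $n\ge 0$ $$\det\bigl(b(i+j)\bigr)_{i,j=0}^{n-1}=(-1)^{\binom n2}2^{n-1}L_n$$ and $$\det\bigl(b(i+j+1)\bigr)_{i,j=0}^{n-1}=(-1)^{\binom{n+1}2}2^{n}L_{2\lfloor n/2\rfloor+1}.$$
   Context: $L_n$ is the Lucas sequence $L_0=2$, $L_1=1$, $L_n=L_{n-1}+L_{n-2}$. The determinant of the empty ($0\times 0$) matrix is $1$ (so for $n=0$ the first formula reads $2^{ -1}L_0=1$). -}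

module Defs where

open import Algebra.Bundles.Raw using (RawRing)
open import Data.Fin.Base using (Fin; zero; suc; toℕ; punchIn)
open import Data.Integer.Base as ℤ using (ℤ; +_; -[1+_]; -1ℤ; 1ℤ)
open import Data.List.Base using (_∷_; []; map; upTo)
open import Data.Nat.Base as ℕ using (ℕ; zero; suc; ⌈_/2⌉)
open import Data.Nat.Combinatorics using (_C_)
open import Data.Nat.Properties using (n≡⌈n+n/2⌉; n≡⌊n+n/2⌋; +-identityʳ; +-suc)
open import Data.Rational.Base as ℚ using (ℚ; NonZero)
open import Level using (Level)
open import Relation.Binary.PropositionalEquality using (_≡_; refl; cong; sym; trans)

import Algebra.Definitions.RawMonoid as RawMonoidDefs
import Algebra.Definitions.RawSemiring as RawSemiringDefs

module Determinant {c ℓ : Level} (R : RawRing c ℓ) where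

  open RawRing R
  open RawMonoidDefs +-rawMonoid using (sum)
  open RawSemiringDefs rawSemiring using (_^_)

  Matrix : ℕ → Set c
  Matrix n = Fin n → Fin n → Carrier

  -- Delete row zero and column j.
  minor : ∀ {n} → Matrix (suc n) → Fin (suc n) → Matrix n
  minor A j i k = A (suc i) (punchIn j k)

  -- Laplace expansion along the first row.
  det : ∀ {n} → Matrix n → Carrier
  det {zero}  A = 1#
  det {suc n} A = sum (λ j → (- 1#) ^ toℕ j * (A zero j * det (minor A j)))

open Determinant ℤ.+-*-rawRing public

Lucas : ℕ → ℕ
Lucas zero          = 2
Lucas (suc zero)    = 1
Lucas (suc (suc n)) = Lucas (suc n) ℕ.+ Lucas n

B : ℕ → ℕ
B m = (2 ℕ.* m) C m

signedB : ℕ → ℤ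
signedB m = (-1ℤ ℤ.^ m) ℤ.* (+ B m)

-- ⌈ n /2⌉ is 0 for n = 0, and is m for both n = 2m ∸ 1 and n = 2m when m ≥ 1
-- (see b-odd and b-even).
b : ℕ → ℤ
b n = signedB ⌈ n /2⌉

b-zero : b 0 ≡ 1ℤ
b-zero = refl

b-even : ∀ m → b (2 ℕ.* m) ≡ signedB m
b-even m = cong signedB (trans (cong (λ k → ⌈ m ℕ.+ k /2⌉) (+-identityʳ m)) (sym (n≡⌈n+n/2⌉ m)))

b-odd : ∀ m → 1 ℕ.≤ m → b (2 ℕ.* m ℕ.∸ 1) ≡ signedB m
b-odd (suc k) _ = cong signedB (trans
  (cong ⌈_/2⌉ (trans (+-suc k (k ℕ.+ 0)) (cong (λ j → suc (k ℕ.+ j)) (+-identityʳ k))))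
  (cong suc (sym (n≡⌊n+n/2⌋ k))))

b-values : map b (upTo 9) ≡
  + 1 ∷ -[1+ 1 ] ∷ -[1+ 1 ] ∷ + 6 ∷ + 6 ∷ -[1+ 19 ] ∷ -[1+ 19 ] ∷ + 70 ∷ + 70 ∷ []
b-values = refl

fromℤ : ℤ → ℚ
fromℤ i = i ℚ./ 1

-- Integer powers of a nonzero rational.
infixr 8 _^ᶻ_
_^ᶻ_ : (q : ℚ) → .{{_ : NonZero q}} → ℤ → ℚ
q ^ᶻ (+ n)    = RawSemiringDefs._^_ ℚ.+-*-rawSemiring q n
q ^ᶻ -[1+ n ] = RawSemiringDefs._^_ ℚ.+-*-rawSemiring (ℚ.1/ q) (suc n)

{-# OPTIONS --safe #-}
module Submission where

-- Put x = z - z⁻¹ and let CT denote the constant term. Then b(r) = CT (1 + x) x^r, and the Lucas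
-- polynomials p_n = z^n + (-z⁻¹)^n, given by p₀ = 2, p₁ = x, p_{n+2} = x p_{n+1} + p_n, are orthogonal
-- for CT. A combination of p_n and p_{n+1} that vanishes at x = -1 has the form (1 + x) q with
-- deg q = n, and CT (1 + x) q x^r = 0 for r < n. Replacing the last column of the Hankel matrix of
-- size n + 1 by the one belonging to q therefore gives a two-term recurrence between the determinants
-- of sizes n and n + 1. For the shifted sequence use a combination of p_n, p_{n+1}, p_{n+2} that
-- vanishes at x = 0 and at x = -1.

open import Defs
open import Data.Fin.Base using (Fin; zero; suc; toℕ; punchIn)
open import Data.Integer.Base as ℤ using (ℤ; +_; -1ℤ; 0ℤ; 1ℤ; _+_; _*_; _-_; -_)
import Data.Integer.Properties as ℤₚ
open import Data.Integer.Tactic.RingSolver using (solve-∀)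
open import Data.List.Base using (List; []; _∷_; _++_; _∷ʳ_; applyUpTo)
open import Data.List.Membership.Propositional using (_∈_)
open import Data.List.Membership.Propositional.Properties using (∈-applyUpTo⁺)
open import Data.List.Properties using (applyUpTo-∷ʳ)
open import Data.List.Relation.Unary.Any using (here; there)
open import Data.Nat.Base as ℕ using (ℕ; zero; suc; ⌊_/2⌋; _<_; _≤_; s≤s; z≤n)
open import Data.Nat.Combinatorics using (_C_; nC1≡n; nCn≡1; nCk≡nC[n∸k]; nCk+nC[k+1]≡[n+1]C[k+1])
import Data.Nat.Properties as ℕₚ
open import Data.Product.Base using (_×_; _,_; ∃; proj₁; proj₂)
import Data.Rational.Base as ℚ
import Data.Rational.Properties as ℚₚ
open import Data.Rational.Unnormalised.Base as ℚᵘ using (mkℚᵘ)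
import Data.Rational.Unnormalised.Properties as ℚᵘₚ
open import Data.Sum.Base using (_⊎_; inj₁; inj₂)
open import Data.Vec.Base as Vec using (Vec; []; _∷_; lookup; removeAt; toList)
open import Data.Vec.Properties using (lookup∘tabulate)
open import Function.Base using (_∘_)
open import Relation.Binary.PropositionalEquality using (_≡_; _≗_; refl; sym; trans; cong; cong₂; subst; module ≡-Reasoning)
open import Algebra.Properties.Monoid.Sum ℤₚ.+-0-monoid using (sum; sum-cong-≗)
open import Algebra.Properties.Semiring.Sum ℤₚ.+-*-semiring using (*-distribˡ-sum)
open import Algebra.Definitions.RawSemiring ℤ.+-*-rawSemiring using () renaming (_^_ to _^ᴿ_)
open import Algebra.Definitions.RawSemiring ℚ.+-*-rawSemiring using () renaming (_^_ to _^ℚ_)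

Seq : Set
Seq = ℕ → ℤ

shift : Seq → Seq
shift f r = f (suc r)

-- Determinants as alternating forms in the list of columns

-- `F` evaluates the minors. Precomposing it with `c ∷_` retains a column already passed, and the
-- nested subtraction produces the alternating signs.
expand : (List Seq → ℤ) → ℕ → List Seq → ℤ
expand F r []       = 0ℤ
expand F r (c ∷ cs) = c r * F cs - expand (F ∘ (c ∷_)) r cs

-- The determinant of rows r, …, r + n - 1; zero unless there are exactly n columns.
colDet : ℕ → ℕ → List Seq → ℤ
colDet zero    r []      = 1ℤ
colDet zero    r (_ ∷ _) = 0ℤ
colDet (suc n) r cs      = expand (colDet n (suc r)) r cs

expand-cong : ∀ {F G : List Seq → ℤ} r → (∀ cs → F cs ≡ G cs) → ∀ cs → expand F r cs ≡ expand G r cs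
expand-cong r F≗G []       = refl
expand-cong r F≗G (c ∷ cs) =
  cong₂ (λ x y → c r * x - y) (F≗G cs) (expand-cong r (λ ds → F≗G (c ∷ ds)) cs)

expand-linear : ∀ (F G : List Seq → ℤ) r x y cs →
  expand (λ ds → x * F ds + y * G ds) r cs ≡ x * expand F r cs + y * expand G r cs
expand-linear F G r x y []       = rearrange x y
  where
  rearrange : ∀ x y → 0ℤ ≡ x * 0ℤ + y * 0ℤ
  rearrange = solve-∀
expand-linear F G r x y (c ∷ cs) = trans
  (cong (λ z → c r * (x * F cs + y * G cs) - z) (expand-linear (F ∘ (c ∷_)) (G ∘ (c ∷_)) r x y cs))
  (rearrange x y (c r) (F cs) (G cs) _ _)
  where
  rearrange : ∀ x y c s t u v →
    c * (x * s + y * t) - (x * u + y * v) ≡ x * (c * s - u) + y * (c * t - v)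
  rearrange = solve-∀

expand-zero : ∀ {F : List Seq → ℤ} r → (∀ cs → F cs ≡ 0ℤ) → ∀ cs → expand F r cs ≡ 0ℤ
expand-zero     r F≗0 []       = refl
expand-zero {F} r F≗0 (c ∷ cs) = trans
  (cong₂ (λ x y → c r * x - y) (F≗0 cs) (expand-zero r (λ ds → F≗0 (c ∷ ds)) cs))
  (rearrange (c r))
  where
  rearrange : ∀ c → c * 0ℤ - 0ℤ ≡ 0ℤ
  rearrange = solve-∀

-- Vanishing is demanded for equal neighbours; `∈-∷ʳ-vanish` extends it to a repeated last column by
-- means of `swap`. `resp` stands in for function extensionality on columns.
record IsAlternating (F : List Seq → ℤ) : Set where
  field
    resp      : ∀ pre post {g h} → g ≗ h → F (pre ++ g ∷ post) ≡ F (pre ++ h ∷ post)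
    linear    : ∀ pre post x y g h →
                F (pre ++ (λ r → x * g r + y * h r) ∷ post)
                  ≡ x * F (pre ++ g ∷ post) + y * F (pre ++ h ∷ post)
    alternate : ∀ pre post g → F (pre ++ g ∷ g ∷ post) ≡ 0ℤ

open IsAlternating

∷-alternating : ∀ {F} → IsAlternating F → ∀ c → IsAlternating (F ∘ (c ∷_))
∷-alternating alt c .resp      pre = alt .resp (c ∷ pre)
∷-alternating alt c .linear    pre = alt .linear (c ∷ pre)
∷-alternating alt c .alternate pre = alt .alternate (c ∷ pre)

expand-resp : ∀ {F} r → IsAlternating F → ∀ pre post {g h} → g ≗ h →
  expand F r (pre ++ g ∷ post) ≡ expand F r (pre ++ h ∷ post)
expand-resp {F} r alt []        post g≗h =
  cong₂ (λ x y → x * F post - y) (g≗h r) (expand-cong r (λ ds → alt .resp [] ds g≗h) post)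
expand-resp     r alt (c ∷ pre) post g≗h =
  cong₂ (λ x y → c r * x - y) (alt .resp pre post g≗h) (expand-resp r (∷-alternating alt c) pre post g≗h)

expand-multilinear : ∀ {F} r → IsAlternating F → ∀ pre post x y g h →
  expand F r (pre ++ (λ s → x * g s + y * h s) ∷ post)
    ≡ x * expand F r (pre ++ g ∷ post) + y * expand F r (pre ++ h ∷ post)
expand-multilinear {F} r alt [] post x y g h = trans
  (cong (λ z → (x * g r + y * h r) * F post - z)
    (trans (expand-cong r (λ ds → alt .linear [] ds x y g h) post) (expand-linear _ _ r x y post)))
  (rearrange x y (g r) (h r) (F post) _ _)
  where
  rearrange : ∀ x y c d s u v →
    (x * c + y * d) * s - (x * u + y * v) ≡ x * (c * s - u) + y * (d * s - v)
  rearrange = solve-∀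
expand-multilinear {F} r alt (c ∷ pre) post x y g h = trans
  (cong₂ (λ w z → c r * w - z) (alt .linear pre post x y g h)
    (expand-multilinear r (∷-alternating alt c) pre post x y g h))
  (rearrange x y (c r) _ _ _ _)
  where
  rearrange : ∀ x y c s t u v →
    c * (x * s + y * t) - (x * u + y * v) ≡ x * (c * s - u) + y * (c * t - v)
  rearrange = solve-∀

-- When the equal columns come first, the two terms that delete one of them cancel, and every other
-- minor still contains both. Columns before them are absorbed into the form.
expand-alternate : ∀ {F} r → IsAlternating F → ∀ pre post g → expand F r (pre ++ g ∷ g ∷ post) ≡ 0ℤ
expand-alternate {F} r alt [] post g = trans
  (cong (λ z → g r * F (g ∷ post) - (g r * F (g ∷ post) - z))
    (expand-zero r (λ ds → alt .alternate [] ds g) post))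
  (rearrange (g r * F (g ∷ post)))
  where
  rearrange : ∀ x → x - (x - 0ℤ) ≡ 0ℤ
  rearrange = solve-∀
expand-alternate r alt (c ∷ pre) post g = trans
  (cong₂ (λ w z → c r * w - z) (alt .alternate pre post g)
    (expand-alternate r (∷-alternating alt c) pre post g))
  (rearrange (c r))
  where
  rearrange : ∀ c → c * 0ℤ - 0ℤ ≡ 0ℤ
  rearrange = solve-∀

expand-alternating : ∀ {F} r → IsAlternating F → IsAlternating (expand F r)
expand-alternating r alt .resp      = expand-resp r alt
expand-alternating r alt .linear    = expand-multilinear r alt
expand-alternating r alt .alternate = expand-alternate r alt

colDet-alternating : ∀ n r → IsAlternating (colDet n r)
colDet-alternating zero r .resp [] post g≗h = refl
colDet-alternating zero r .resp (_ ∷ _) post g≗h = refl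
colDet-alternating zero r .linear [] post x y g h = rearrange x y
  where
  rearrange : ∀ x y → 0ℤ ≡ x * 0ℤ + y * 0ℤ
  rearrange = solve-∀
colDet-alternating zero r .linear (_ ∷ _) post x y g h = rearrange x y
  where
  rearrange : ∀ x y → 0ℤ ≡ x * 0ℤ + y * 0ℤ
  rearrange = solve-∀
colDet-alternating zero r .alternate [] post g = refl
colDet-alternating zero r .alternate (_ ∷ _) post g = refl
colDet-alternating (suc n) r = expand-alternating r (colDet-alternating n (suc r))

-- Polarisation: the form vanishes with g + h in both slots, and so do the two terms of its
-- expansion with a repeated column.
swap : ∀ {F} → IsAlternating F → ∀ g h post → F (g ∷ h ∷ post) ≡ - F (h ∷ g ∷ post)
swap {F} alt g h post = cancel (F (g ∷ g ∷ post)) (F (g ∷ h ∷ post)) _ (F (h ∷ h ∷ post))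
  (alt .alternate [] post g) (alt .alternate [] post h)
  (begin
    1ℤ * (1ℤ * F (g ∷ g ∷ post) + 1ℤ * F (g ∷ h ∷ post)) + 1ℤ * (1ℤ * F (h ∷ g ∷ post) + 1ℤ * F (h ∷ h ∷ post))
      ≡⟨ cong₂ (λ x y → 1ℤ * x + 1ℤ * y) (alt .linear (g ∷ []) post 1ℤ 1ℤ g h) (alt .linear (h ∷ []) post 1ℤ 1ℤ g h) ⟨
    1ℤ * F (g ∷ s ∷ post) + 1ℤ * F (h ∷ s ∷ post)
      ≡⟨ alt .linear [] (s ∷ post) 1ℤ 1ℤ g h ⟨
    F (s ∷ s ∷ post)
      ≡⟨ alt .alternate [] post s ⟩
    0ℤ ∎)
  where
  open ≡-Reasoning
  s : Seq
  s r = 1ℤ * g r + 1ℤ * h r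
  rearrange : ∀ x y → x ≡ 1ℤ * (1ℤ * 0ℤ + 1ℤ * x) + 1ℤ * (1ℤ * y + 1ℤ * 0ℤ) - y
  rearrange = solve-∀
  cancel : ∀ w x y z → w ≡ 0ℤ → z ≡ 0ℤ → 1ℤ * (1ℤ * w + 1ℤ * x) + 1ℤ * (1ℤ * y + 1ℤ * z) ≡ 0ℤ → x ≡ - y
  cancel _ x y _ refl refl eq = trans (rearrange x y) (trans (cong (_- y) eq) (ℤₚ.+-identityˡ (- y)))

-- Columns before the located copy of `g` are held fixed; `swap` then moves that copy rightwards
-- until it meets the last column.
∈-∷ʳ-vanish : ∀ {F} → IsAlternating F → ∀ {g cs} → g ∈ cs → F (cs ∷ʳ g) ≡ 0ℤ
∈-∷ʳ-vanish alt {cs = c ∷ cs} (there g∈cs) = ∈-∷ʳ-vanish (∷-alternating alt c) g∈cs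
∈-∷ʳ-vanish alt {g} {_ ∷ cs} (here refl)   = go alt cs
  where
  go : ∀ {F} → IsAlternating F → ∀ cs → F (g ∷ cs ∷ʳ g) ≡ 0ℤ
  go alt []       = alt .alternate [] [] g
  go alt (c ∷ cs) = trans (swap alt g c (cs ∷ʳ g)) (cong -_ (go (∷-alternating alt c) cs))

-- The term deleting the last column has the coefficient `g r`, which is zero; all other minors keep
-- `g` as their last column.
expand-∷ʳ : ∀ F r g → g r ≡ 0ℤ → ∀ cs → expand F r (cs ∷ʳ g) ≡ expand (F ∘ (_∷ʳ g)) r cs
expand-∷ʳ F r g gr≡0 []       = cong (λ x → x * F [] - 0ℤ) gr≡0
expand-∷ʳ F r g gr≡0 (c ∷ cs) =
  cong (λ x → c r * F (cs ∷ʳ g) - x) (expand-∷ʳ (F ∘ (c ∷_)) r g gr≡0 cs)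

-- Expanding from the top row, each zero of `g` removes the term of the last column, until only its
-- corner entry is left. That entry lies on the diagonal, hence the sign +.
colDet-∷ʳ : ∀ n r g → (∀ {i} → i < n → g (i ℕ.+ r) ≡ 0ℤ) →
  ∀ cs → colDet (suc n) r (cs ∷ʳ g) ≡ g (n ℕ.+ r) * colDet n r cs
colDet-∷ʳ zero r g _ []       = rearrange (g r)
  where
  rearrange : ∀ x → x * 1ℤ - 0ℤ ≡ x * 1ℤ
  rearrange = solve-∀
-- At least two columns over a single row: both sides are zero.
colDet-∷ʳ zero r g _ (c ∷ cs) = trans
  (cong₂ (λ x y → c r * x - y) (nonempty cs) (expand-zero {λ ds → colDet zero (suc r) (c ∷ ds)} r (λ _ → refl) (cs ∷ʳ g)))
  (rearrange (c r) (g r))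
  where
  nonempty : ∀ cs → colDet zero (suc r) (cs ∷ʳ g) ≡ 0ℤ
  nonempty []      = refl
  nonempty (_ ∷ _) = refl
  rearrange : ∀ x y → x * 0ℤ - 0ℤ ≡ y * 0ℤ
  rearrange = solve-∀
colDet-∷ʳ (suc n) r g vanish cs = begin
  expand (colDet (suc n) (suc r)) r (cs ∷ʳ g)
    ≡⟨ expand-∷ʳ (colDet (suc n) (suc r)) r g (vanish (s≤s z≤n)) cs ⟩
  expand (λ ds → colDet (suc n) (suc r) (ds ∷ʳ g)) r cs
    ≡⟨ expand-cong r (λ ds → trans (colDet-∷ʳ n (suc r) g vanish′ ds) (pad (g (n ℕ.+ suc r)) (colDet n (suc r) ds))) cs ⟩
  expand (λ ds → g (n ℕ.+ suc r) * colDet n (suc r) ds + 0ℤ * 0ℤ) r cs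
    ≡⟨ expand-linear (colDet n (suc r)) (λ _ → 0ℤ) r (g (n ℕ.+ suc r)) 0ℤ cs ⟩
  g (n ℕ.+ suc r) * colDet (suc n) r cs + 0ℤ * expand (λ _ → 0ℤ) r cs
    ≡⟨ unpad (g (n ℕ.+ suc r)) (colDet (suc n) r cs) (expand (λ _ → 0ℤ) r cs) ⟩
  g (n ℕ.+ suc r) * colDet (suc n) r cs
    ≡⟨ cong (λ i → g i * colDet (suc n) r cs) (ℕₚ.+-suc n r) ⟩
  g (suc n ℕ.+ r) * colDet (suc n) r cs ∎
  where
  open ≡-Reasoning
  vanish′ : ∀ {i} → i < n → g (i ℕ.+ suc r) ≡ 0ℤ
  vanish′ {i} i<n = trans (cong g (ℕₚ.+-suc i r)) (vanish (s≤s i<n))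
  pad : ∀ x y → x * y ≡ x * y + 0ℤ * 0ℤ
  pad = solve-∀
  unpad : ∀ x y z → x * y + 0ℤ * z ≡ x * y
  unpad = solve-∀

-- Comparison with the Laplace expansion; Hankel determinants

lookup-removeAt : ∀ {n} (cs : Vec Seq (suc n)) j k → lookup (removeAt cs j) k ≡ lookup cs (punchIn j k)
lookup-removeAt (c ∷ cs)       zero    k       = refl
lookup-removeAt (c ∷ cs@(_ ∷ _)) (suc j) zero    = refl
lookup-removeAt (c ∷ cs@(_ ∷ _)) (suc j) (suc k) = lookup-removeAt cs j k

-- Pulling one factor -1 out of the tail of the sum turns the signs (-1)^j into the nested
-- subtractions of `expand`.
sum-expand : ∀ {n} (F : List Seq → ℤ) r (cs : Vec Seq (suc n)) →
  sum (λ j → -1ℤ ^ᴿ toℕ j * (lookup cs j r * F (toList (removeAt cs j)))) ≡ expand F r (toList cs)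
sum-expand F r (c ∷ []) = rearrange (c r * F [])
  where
  rearrange : ∀ x → 1ℤ * x + 0ℤ ≡ x - 0ℤ
  rearrange = solve-∀
sum-expand F r (c ∷ cs@(_ ∷ _)) = begin
  1ℤ * x + sum (λ j → -1ℤ * -1ℤ ^ᴿ toℕ j * t j)
    ≡⟨ cong (λ y → 1ℤ * x + y) (sum-cong-≗ (λ j → ℤₚ.*-assoc -1ℤ (-1ℤ ^ᴿ toℕ j) (t j))) ⟩
  1ℤ * x + sum (λ j → -1ℤ * (-1ℤ ^ᴿ toℕ j * t j))
    ≡⟨ cong (λ y → 1ℤ * x + y) (*-distribˡ-sum -1ℤ (λ j → -1ℤ ^ᴿ toℕ j * t j)) ⟨
  1ℤ * x + -1ℤ * sum (λ j → -1ℤ ^ᴿ toℕ j * t j)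
    ≡⟨ cong (λ y → 1ℤ * x + -1ℤ * y) (sum-expand (F ∘ (c ∷_)) r cs) ⟩
  1ℤ * x + -1ℤ * expand (F ∘ (c ∷_)) r (toList cs)
    ≡⟨ rearrange x _ ⟩
  x - expand (F ∘ (c ∷_)) r (toList cs) ∎
  where
  open ≡-Reasoning
  x = c r * F (toList cs)
  t : Fin _ → ℤ
  t j = lookup cs j r * F (c ∷ toList (removeAt cs j))
  rearrange : ∀ x y → 1ℤ * x + -1ℤ * y ≡ x - y
  rearrange = solve-∀

-- Deleting row zero only raises the offset `r`, so the minors are described by the same column
-- functions.
det≡colDet : ∀ {n} (A : Matrix n) r (cs : Vec Seq n) →
  (∀ i j → A i j ≡ lookup cs j (toℕ i ℕ.+ r)) → det A ≡ colDet n r (toList cs)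
det≡colDet {zero}  A r []           _   = refl
det≡colDet {suc n} A r cs A≡ = trans
  (sum-cong-≗ {suc n} (λ j → cong₂ (λ x y → -1ℤ ^ᴿ toℕ j * (x * y)) (A≡ zero j)
    (det≡colDet (minor A j) (suc r) (removeAt cs j) (minor≡ j))))
  (sum-expand (colDet n (suc r)) r cs)
  where
  minor≡ : ∀ j i k → minor A j i k ≡ lookup (removeAt cs j) k (toℕ i ℕ.+ suc r)
  minor≡ j i k = trans (A≡ (suc i) (punchIn j k))
    (cong₂ (λ c m → c m) (sym (lookup-removeAt cs j k)) (sym (ℕₚ.+-suc (toℕ i) r)))

toList-tabulate : ∀ (g : ℕ → Seq) n → toList (Vec.tabulate {n = n} (g ∘ toℕ)) ≡ applyUpTo g n
toList-tabulate g zero    = refl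
toList-tabulate g (suc n) = cong (g 0 ∷_) (toList-tabulate (g ∘ suc) n)

shifts : Seq → ℕ → List Seq
shifts f = applyUpTo (λ k r → f (k ℕ.+ r))

hankel : Seq → ℕ → ℤ
hankel f n = colDet n 0 (shifts f n)

det≡hankel : ∀ n f (A : Matrix n) → (∀ i j → A i j ≡ f (toℕ i ℕ.+ toℕ j)) → det A ≡ hankel f n
det≡hankel n f A A≡ = trans
  (det≡colDet A 0 (Vec.tabulate (col ∘ toℕ)) entry)
  (cong (colDet n 0) (toList-tabulate col n))
  where
  col : ℕ → Seq
  col k r = f (k ℕ.+ r)
  entry : ∀ i j → A i j ≡ lookup (Vec.tabulate (col ∘ toℕ)) j (toℕ i ℕ.+ 0)
  entry i j = trans (A≡ i j) (trans (cong f eq) (cong (λ c → c (toℕ i ℕ.+ 0)) (sym (lookup∘tabulate (col ∘ toℕ) j))))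
    where
    eq : toℕ i ℕ.+ toℕ j ≡ toℕ j ℕ.+ (toℕ i ℕ.+ 0)
    eq = trans (ℕₚ.+-comm (toℕ i) (toℕ j)) (cong (toℕ j ℕ.+_) (sym (ℕₚ.+-identityʳ (toℕ i))))

-- Combinations of shifts of a sequence

-- Combinations of the first `n` shifts of `f`, with the coefficients peeled off from the top down.
-- A coefficient may be zero, so `n` is a strict bound on the degree.
data Span (f : Seq) : ℕ → Seq → Set where
  null : ∀ {g} → (∀ r → g r ≡ 0ℤ) → Span f zero g
  lead : ∀ {n g} a → Span f n (λ r → g r - a * f (n ℕ.+ r)) → Span f (suc n) g

-- g = q(S) f for the shift S and a polynomial q = a x^n + (lower terms).
Leading : ℤ → Seq → ℕ → Seq → Set
Leading a f n g = Span f n (λ r → g r - a * f (n ℕ.+ r))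

span-resp : ∀ {f n g h} → g ≗ h → Span f n g → Span f n h
span-resp g≗h (null G)   = null (λ r → trans (sym (g≗h r)) (G r))
span-resp g≗h (lead a G) = lead a (span-resp (λ r → cong (_- _) (g≗h r)) G)

span-combine : ∀ {f n g h} x y → Span f n g → Span f n h → Span f n (λ r → x * g r + y * h r)
span-combine x y (null G) (null H) =
  null (λ r → trans (cong₂ (λ s t → x * s + y * t) (G r) (H r)) (rearrange x y))
  where
  rearrange : ∀ x y → x * 0ℤ + y * 0ℤ ≡ 0ℤ
  rearrange = solve-∀
span-combine {f} {suc n} {g} {h} x y (lead a G) (lead b H) =
  lead (x * a + y * b)
    (span-resp (λ r → rearrange x y a b (g r) (h r) (f (n ℕ.+ r))) (span-combine x y G H))
  where
  rearrange : ∀ x y a b g h f →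
    x * (g - a * f) + y * (h - b * f) ≡ x * g + y * h - (x * a + y * b) * f
  rearrange = solve-∀

span-suc : ∀ {f n g} → Span f n g → Span f (suc n) g
span-suc {f} {n} {g} G = lead 0ℤ (span-resp (λ r → rearrange (g r) (f (n ℕ.+ r))) G)
  where
  rearrange : ∀ g f → g ≡ g - 0ℤ * f
  rearrange = solve-∀

span-shift : ∀ {f n g} → Span f n g → Span f (suc n) (shift g)
span-shift (null G) = span-suc (null (λ r → G (suc r)))
span-shift {f} {suc n} {g} (lead a G) =
  lead a (span-resp (λ r → cong (λ i → g (suc r) - a * f i) (ℕₚ.+-suc n r)) (span-shift G))

span-self : ∀ {f} n → Span f (suc n) f
span-self {f} zero    = lead 1ℤ (null (λ r → rearrange (f r)))
  where
  rearrange : ∀ x → x - 1ℤ * x ≡ 0ℤ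
  rearrange = solve-∀
span-self {f} (suc n) = span-suc (span-self n)

-- If `g n` is q_n(S) f, then q_{n+2} = x q_{n+1} + q_n + c_n with q_0 = 0 and q_1 = 1, so q_{n+1}
-- stays monic of degree n.
span-recurrence : ∀ {f} (g : ℕ → Seq) (c : ℕ → ℤ) →
  (∀ n r → g (2 ℕ.+ n) r ≡ g (1 ℕ.+ n) (suc r) + g n r + c n * f r) →
  Span f 0 (g 0) → Leading 1ℤ f 0 (g 1) →
  ∀ n → Span f n (g n) × Leading 1ℤ f n (g (suc n))
span-recurrence g c rec G₀ G₁ zero = G₀ , G₁
span-recurrence {f} g c rec G₀ G₁ (suc n) with span-recurrence {f} g c rec G₀ G₁ n
... | Gₙ , Gₙ₊₁ = lead 1ℤ Gₙ₊₁ , span-resp eq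
  (span-combine 1ℤ (c n) (span-combine 1ℤ 1ℤ (span-shift Gₙ₊₁) (span-suc Gₙ)) (span-self n))
  where
  rearrange : ∀ x y z c f → 1ℤ * (1ℤ * (x - 1ℤ * z) + 1ℤ * y) + c * f ≡ x + y + c * f - 1ℤ * z
  rearrange = solve-∀
  eq : ∀ r → 1ℤ * (1ℤ * (g (suc n) (suc r) - 1ℤ * f (n ℕ.+ suc r)) + 1ℤ * g n r) + c n * f r
           ≡ g (2 ℕ.+ n) r - 1ℤ * f (suc n ℕ.+ r)
  eq r = trans (rearrange (g (suc n) (suc r)) (g n r) (f (n ℕ.+ suc r)) (c n) (f r))
    (cong₂ (λ s i → s - 1ℤ * f i) (sym (rec n r)) (ℕₚ.+-suc n r))

-- By linearity the last column splits into shifts of `f`, each of which is already among the first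
-- `N` columns.
span-vanish : ∀ {f F n N g} → IsAlternating F → n ≤ N → Span f n g → F (shifts f N ∷ʳ g) ≡ 0ℤ
span-vanish {f} {F} {_} {N} {g} alt n≤N (null G) = begin
  F (cs ∷ʳ g)                            ≡⟨ alt .resp cs [] G ⟩
  -- The zero column is written as a combination with zero coefficients, so that linearity applies.
  F (cs ∷ʳ (λ r → 0ℤ * g r + 0ℤ * g r)) ≡⟨ alt .linear cs [] 0ℤ 0ℤ g g ⟩
  0ℤ * F (cs ∷ʳ g) + 0ℤ * F (cs ∷ʳ g) ≡⟨⟩
  0ℤ ∎
  where
  open ≡-Reasoning
  cs = shifts f N
span-vanish {f} {F} {suc n} {N} {g} alt n<N (lead a G) = begin
  F (cs ∷ʳ g)
    ≡⟨ alt .resp cs [] (λ r → rearrange a (g r) (f (n ℕ.+ r))) ⟩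
  F (cs ∷ʳ (λ r → 1ℤ * (g r - a * f (n ℕ.+ r)) + a * f (n ℕ.+ r)))
    ≡⟨ alt .linear cs [] 1ℤ a (λ r → g r - a * f (n ℕ.+ r)) (λ r → f (n ℕ.+ r)) ⟩
  1ℤ * F (cs ∷ʳ (λ r → g r - a * f (n ℕ.+ r))) + a * F (cs ∷ʳ (λ r → f (n ℕ.+ r)))
    ≡⟨ cong₂ (λ x y → 1ℤ * x + a * y) (span-vanish alt (ℕₚ.<⇒≤ n<N) G)
         (∈-∷ʳ-vanish alt (∈-applyUpTo⁺ (λ k r → f (k ℕ.+ r)) n<N)) ⟩
  1ℤ * 0ℤ + a * 0ℤ
    ≡⟨ zeroes a ⟩
  0ℤ ∎
  where
  open ≡-Reasoning
  cs = shifts f N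
  rearrange : ∀ a g f → g ≡ 1ℤ * (g - a * f) + a * f
  rearrange = solve-∀
  zeroes : ∀ a → 1ℤ * 0ℤ + a * 0ℤ ≡ 0ℤ
  zeroes = solve-∀

-- Replacing the last column of the Hankel matrix by g is a column operation; if g vanishes above the
-- diagonal, expanding along the new column leaves a single term.
hankel-step : ∀ a {f n g} → Leading a f n g → (∀ {i} → i < n → g i ≡ 0ℤ) →
  a * hankel f (suc n) ≡ g n * hankel f n
hankel-step a {f} {n} {g} G vanish = begin
  a * colDet (suc n) 0 (shifts f (suc n))
    ≡⟨ cong (λ cs → a * colDet (suc n) 0 cs) (applyUpTo-∷ʳ (λ k r → f (k ℕ.+ r)) n) ⟨
  a * F (λ r → f (n ℕ.+ r))
    ≡⟨ pad a _ ⟩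
  1ℤ * 0ℤ + a * F (λ r → f (n ℕ.+ r))
    ≡⟨ cong (λ x → 1ℤ * x + a * F (λ r → f (n ℕ.+ r))) (span-vanish alt ℕₚ.≤-refl G) ⟨
  1ℤ * F (λ r → g r - a * f (n ℕ.+ r)) + a * F (λ r → f (n ℕ.+ r))
    ≡⟨ alt .linear cs [] 1ℤ a (λ r → g r - a * f (n ℕ.+ r)) (λ r → f (n ℕ.+ r)) ⟨
  F (λ r → 1ℤ * (g r - a * f (n ℕ.+ r)) + a * f (n ℕ.+ r))
    ≡⟨ alt .resp cs [] (λ r → rearrange a (g r) (f (n ℕ.+ r))) ⟨
  F g
    ≡⟨ colDet-∷ʳ n 0 g (λ {i} i<n → trans (cong g (ℕₚ.+-identityʳ i)) (vanish i<n)) cs ⟩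
  g (n ℕ.+ 0) * hankel f n
    ≡⟨ cong (λ i → g i * hankel f n) (ℕₚ.+-identityʳ n) ⟩
  g n * hankel f n ∎
  where
  open ≡-Reasoning
  cs = shifts f n
  F : Seq → ℤ
  F h = colDet (suc n) 0 (cs ∷ʳ h)
  alt = colDet-alternating (suc n) 0
  pad : ∀ a x → a * x ≡ 1ℤ * 0ℤ + a * x
  pad = solve-∀
  rearrange : ∀ a g f → g ≡ 1ℤ * (g - a * f) + a * f
  rearrange = solve-∀

-- Constant terms

-- e k r = CT x^r z^k. As z ↦ -z⁻¹ fixes x and CT, e (-1) = - e 1, which gives the factor 2 below.
e : ℕ → Seq
e zero    zero    = 1ℤ
e (suc k) zero    = 0ℤ
e zero    (suc r) = + 2 * e 1 r
e (suc k) (suc r) = e (2 ℕ.+ k) r - e k r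

ε : ℕ → ℤ
ε n = -1ℤ ℤ.^ n

ε-double : ∀ m → ε (m ℕ.+ m) ≡ 1ℤ
ε-double zero    = refl
ε-double (suc m) = trans (cong (λ i → -1ℤ * ε i) (ℕₚ.+-suc m m)) (cong (λ x → -1ℤ * (-1ℤ * x)) (ε-double m))

-- `e k r` is the coefficient of z^(-k) in x^r, whose lowest power is z^(-r). Doubled, this is the
-- orthogonality of p_k to x^r for r < k.
e-vanish : ∀ {k r} → r < k → e k r ≡ 0ℤ
e-vanish {suc k} {zero}  _         = refl
e-vanish {suc k} {suc r} (s≤s r<k) = cong₂ _-_ (e-vanish (ℕₚ.m<n⇒m<1+n (ℕₚ.m<n⇒m<1+n r<k))) (e-vanish r<k)

e-diagonal : ∀ n → e n n ≡ ε n
e-diagonal zero    = refl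
e-diagonal (suc n) = trans
  (cong₂ _-_ (e-vanish (ℕₚ.m<n⇒m<1+n (ℕₚ.n<1+n n))) (e-diagonal n))
  (rearrange (ε n))
  where
  rearrange : ∀ x → 0ℤ - x ≡ -1ℤ * x
  rearrange = solve-∀

-- Binomial form of the constant terms and their relation to `b`

nC0≡1 : ∀ n → n C 0 ≡ 1
nC0≡1 n = trans (nCk≡nC[n∸k] {n = n} z≤n) (nCn≡1 n)

pascal : ∀ n k → + (suc n C suc k) ≡ + (n C k) + + (n C suc k)
pascal n k = cong +_ (sym (nCk+nC[k+1]≡[n+1]C[k+1] n k))

middle-sym : ∀ m → (m ℕ.+ suc m) C suc m ≡ (m ℕ.+ suc m) C m
middle-sym m = trans (nCk≡nC[n∸k] (ℕₚ.m≤n+m (suc m) m)) (cong ((m ℕ.+ suc m) C_) (ℕₚ.m+n∸n≡m m (suc m)))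

-- The power z^(-k) in (z - z⁻¹)^r takes z from m factors and -z⁻¹ from the other k + m. The
-- induction is Pascal's rule; for k = 0 the doubling comes from the two equal middle binomials.
e-even : ∀ r k m → k ℕ.+ (m ℕ.+ m) ≡ r → e k r ≡ ε (k ℕ.+ m) * + (r C m)
e-even zero    zero    zero    _    = refl
e-even (suc _) zero    (suc m) refl = begin
  + 2 * e 1 r
    ≡⟨ cong (+ 2 *_) (e-even r 1 m (sym (ℕₚ.+-suc m m))) ⟩
  + 2 * (ε (suc m) * + (r C m))
    ≡⟨ rearrange (ε (suc m)) (+ (r C m)) ⟩
  ε (suc m) * (+ (r C m) + + (r C m))
    ≡⟨ cong (λ x → ε (suc m) * (+ (r C m) + + x)) (middle-sym m) ⟨
  ε (suc m) * (+ (r C m) + + (r C suc m))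
    ≡⟨ cong (ε (suc m) *_) (pascal r m) ⟨
  ε (suc m) * + (suc r C suc m) ∎
  where
  open ≡-Reasoning
  r = m ℕ.+ suc m
  rearrange : ∀ x y → + 2 * (x * y) ≡ x * (y + y)
  rearrange = solve-∀
e-even (suc r) (suc k) zero    refl = begin
  e (2 ℕ.+ k) r - e k r
    ≡⟨ cong₂ _-_ (e-vanish (s≤s (ℕₚ.m≤n⇒m≤1+n (ℕₚ.≤-reflexive (ℕₚ.+-identityʳ k))))) (e-even r k zero refl) ⟩
  0ℤ - ε (k ℕ.+ 0) * + (r C 0)
    ≡⟨ cong (λ x → 0ℤ - ε (k ℕ.+ 0) * + x) (trans (nC0≡1 r) (sym (nC0≡1 (suc r)))) ⟩
  0ℤ - ε (k ℕ.+ 0) * + (suc r C 0)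
    ≡⟨ rearrange (ε (k ℕ.+ 0)) (+ (suc r C 0)) ⟩
  ε (suc k ℕ.+ 0) * + (suc r C 0) ∎
  where
  open ≡-Reasoning
  rearrange : ∀ x y → 0ℤ - x * y ≡ -1ℤ * x * y
  rearrange = solve-∀
e-even (suc r) (suc k) (suc m) refl = begin
  e (2 ℕ.+ k) r - e k r
    ≡⟨ cong₂ _-_ (e-even r (2 ℕ.+ k) m eq) (e-even r k (suc m) refl) ⟩
  ε (2 ℕ.+ k ℕ.+ m) * + (r C m) - ε (k ℕ.+ suc m) * + (r C suc m)
    ≡⟨ cong (λ i → ε (suc i) * + (r C m) - ε (k ℕ.+ suc m) * + (r C suc m)) (ℕₚ.+-suc k m) ⟨
  -1ℤ * ε (k ℕ.+ suc m) * + (r C m) - ε (k ℕ.+ suc m) * + (r C suc m)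
    ≡⟨ rearrange (ε (k ℕ.+ suc m)) (+ (r C m)) (+ (r C suc m)) ⟩
  ε (suc k ℕ.+ suc m) * (+ (r C m) + + (r C suc m))
    ≡⟨ cong (ε (suc k ℕ.+ suc m) *_) (pascal r m) ⟨
  ε (suc k ℕ.+ suc m) * + (suc r C suc m) ∎
  where
  open ≡-Reasoning
  eq : 2 ℕ.+ k ℕ.+ (m ℕ.+ m) ≡ k ℕ.+ (suc m ℕ.+ suc m)
  eq = sym (trans (ℕₚ.+-suc k (m ℕ.+ suc m)) (cong suc (trans (cong (k ℕ.+_) (ℕₚ.+-suc m m)) (ℕₚ.+-suc k (m ℕ.+ m)))))
  rearrange : ∀ x y z → -1ℤ * x * y - x * z ≡ -1ℤ * x * (y + z)
  rearrange = solve-∀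

-- Only powers of z with the parity of r occur in x^r.
e-odd : ∀ r k m → k ℕ.+ suc (m ℕ.+ m) ≡ r → e k r ≡ 0ℤ
e-odd (suc _) zero    zero    refl = refl
e-odd (suc _) zero    (suc m) refl = cong (+ 2 *_) (e-odd (suc m ℕ.+ suc m) 1 m (cong suc (sym (ℕₚ.+-suc m m))))
e-odd (suc r) (suc k) zero    refl = cong₂ _-_
  (e-vanish (s≤s (ℕₚ.≤-reflexive (ℕₚ.+-comm k 1)))) (e-odd r k zero refl)
e-odd (suc r) (suc k) (suc m) refl = cong₂ _-_ (e-odd r (2 ℕ.+ k) m eq) (e-odd r k (suc m) refl)
  where
  eq : 2 ℕ.+ k ℕ.+ suc (m ℕ.+ m) ≡ k ℕ.+ suc (suc m ℕ.+ suc m)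
  eq = sym (trans (ℕₚ.+-suc k (suc m ℕ.+ suc m)) (cong suc (trans (ℕₚ.+-suc k (m ℕ.+ suc m)) (cong (λ i → suc (k ℕ.+ i)) (ℕₚ.+-suc m m)))))

parity : ∀ n → ∃ λ m → n ≡ m ℕ.+ m ⊎ n ≡ suc (m ℕ.+ m)
parity zero    = 0 , inj₁ refl
parity (suc n) with parity n
... | m , inj₁ eq = m , inj₂ (cong suc eq)
... | m , inj₂ eq = suc m , inj₁ (cong suc (trans eq (sym (ℕₚ.+-suc m m))))

e₀-double : ∀ m → e 0 (m ℕ.+ m) ≡ signedB m
e₀-double m = trans (e-even (m ℕ.+ m) 0 m refl) (cong (λ i → ε m * + ((m ℕ.+ i) C m)) (sym (ℕₚ.+-identityʳ m)))

-- This is b(r) = CT (1 + x) x^r. Of two consecutive constant terms the one with odd exponent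
-- vanishes, which is why the entries of `b` come in equal pairs.
b≡e₀+shift-e₀ : ∀ r → b r ≡ e 0 r + e 0 (suc r)
b≡e₀+shift-e₀ r with parity r
... | m , inj₁ refl = begin
  signedB ℕ.⌈ m ℕ.+ m /2⌉             ≡⟨ cong signedB (ℕₚ.n≡⌈n+n/2⌉ m) ⟨
  signedB m                           ≡⟨ e₀-double m ⟨
  e 0 (m ℕ.+ m)                       ≡⟨ ℤₚ.+-identityʳ _ ⟨
  e 0 (m ℕ.+ m) + 0ℤ                  ≡⟨ cong (λ x → e 0 (m ℕ.+ m) + x) (e-odd _ 0 m refl) ⟨
  e 0 (m ℕ.+ m) + e 0 (suc (m ℕ.+ m)) ∎
  where open ≡-Reasoning
... | m , inj₂ refl = begin
  signedB (suc ⌊ m ℕ.+ m /2⌋)         ≡⟨ cong (signedB ∘ suc) (ℕₚ.n≡⌊n+n/2⌋ m) ⟨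
  signedB (suc m)                     ≡⟨ e₀-double (suc m) ⟨
  e 0 (suc m ℕ.+ suc m)               ≡⟨ cong (e 0 ∘ suc) (ℕₚ.+-suc m m) ⟩
  e 0 (suc (suc (m ℕ.+ m)))           ≡⟨ ℤₚ.+-identityˡ _ ⟨
  0ℤ + e 0 (suc (suc (m ℕ.+ m)))      ≡⟨ cong (_+ e 0 (suc (suc (m ℕ.+ m)))) (e-odd _ 0 m refl) ⟨
  e 0 (suc (m ℕ.+ m)) + e 0 (suc (suc (m ℕ.+ m))) ∎
  where open ≡-Reasoning

-- Two-term recurrences for the Hankel determinants

-- u n r = CT x^r p_n, by the symmetry z ↦ -z⁻¹.
u : ℕ → Seq
u n r = + 2 * e n r

L : ℕ → ℤ
L n = + Lucas n

hankel-b-step : ∀ n → L n * hankel b (suc n) ≡ + 2 * ε n * L (suc n) * hankel b n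
hankel-b-step n = trans (hankel-step (L n) leading vanish) (cong (_* hankel b n) diagonal)
  where
  -- p_n(-1) = (-1)^n L_n, so g n belongs to p_n - p_n(-1).
  g : ℕ → Seq
  g n r = u n r - ε n * L n * e 0 r
  ring₁ : ∀ s l₁ l₀ x y z w →
    + 2 * x - -1ℤ * (-1ℤ * s) * (l₁ + l₀) * z
      ≡ + 2 * (x - y) - -1ℤ * s * l₁ * w + (+ 2 * y - s * l₀ * z) + -1ℤ * s * l₁ * (z + w)
  ring₁ = solve-∀
  -- Since p_{n+2}(-1) = p_n(-1) - p_{n+1}(-1), the defect of the recurrence is p_{n+1}(-1) (1 + x),
  -- and 1 + x gives `b`.
  g-rec : ∀ n r → g (2 ℕ.+ n) r ≡ g (1 ℕ.+ n) (suc r) + g n r + ε (suc n) * L (suc n) * b r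
  g-rec n r = trans
    (ring₁ (ε n) (L (suc n)) (L n) (e (2 ℕ.+ n) r) (e n r) (e 0 r) (e 0 (suc r)))
    (cong (λ x → g (1 ℕ.+ n) (suc r) + g n r + ε (suc n) * L (suc n) * x) (sym (b≡e₀+shift-e₀ r)))
  ring₂ : ∀ x → + 2 * x - 1ℤ * + 2 * x ≡ 0ℤ
  ring₂ = solve-∀
  ring₃ : ∀ x y → + 2 * x - -1ℤ * 1ℤ * 1ℤ * y - 1ℤ * (y + + 2 * x) ≡ 0ℤ
  ring₃ = solve-∀
  -- The start: p_0 - 2 = 0 and p_1 + 1 = 1 + x.
  spans : ∀ n → Span b n (g n) × Leading 1ℤ b n (g (suc n))
  spans = span-recurrence g (λ n → ε (suc n) * L (suc n)) g-rec
    (null (λ r → ring₂ (e 0 r)))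
    (null (λ r → trans (cong (λ x → g 1 r - 1ℤ * x) (b≡e₀+shift-e₀ r)) (ring₃ (e 1 r) (e 0 r))))
  -- Belongs to L_n p_{n+1} + L_{n+1} p_n: at x = -1 the two terms cancel, having opposite signs.
  v : Seq
  v r = L n * u (suc n) r + L (suc n) * u n r
  ring₄ : ∀ s l₁ l₀ x y z w →
    l₀ * (x - -1ℤ * s * l₁ * z - 1ℤ * w) + l₁ * (y - s * l₀ * z) ≡ l₀ * x + l₁ * y - l₀ * w
  ring₄ = solve-∀
  leading : Leading (L n) b n v
  leading = span-resp
    (λ r → ring₄ (ε n) (L (suc n)) (L n) (u (suc n) r) (u n r) (e 0 r) (b (n ℕ.+ r)))
    (span-combine (L n) (L (suc n)) (proj₂ (spans n)) (proj₁ (spans n)))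
  ring₅ : ∀ x y → x * (+ 2 * 0ℤ) + y * (+ 2 * 0ℤ) ≡ 0ℤ
  ring₅ = solve-∀
  vanish : ∀ {i} → i < n → v i ≡ 0ℤ
  vanish i<n = trans
    (cong₂ (λ x y → L n * (+ 2 * x) + L (suc n) * (+ 2 * y)) (e-vanish (ℕₚ.m<n⇒m<1+n i<n)) (e-vanish i<n))
    (ring₅ (L n) (L (suc n)))
  ring₆ : ∀ x y s → x * (+ 2 * 0ℤ) + y * (+ 2 * s) ≡ + 2 * s * y
  ring₆ = solve-∀
  diagonal : v n ≡ + 2 * ε n * L (suc n)
  diagonal = trans
    (cong₂ (λ x y → L n * (+ 2 * x) + L (suc n) * (+ 2 * y)) (e-vanish (ℕₚ.n<1+n n)) (e-diagonal n))
    (ring₆ (L n) (L (suc n)) (ε n))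

-- α n = p_n(0).
α : ℕ → ℤ
α n = 1ℤ + ε n

-- Up to the sign (-1)^(n+1), the determinant of the values of p_n and p_{n+1} at x = 0 and x = -1.
κ : ℕ → ℤ
κ n = α n * L (suc n) + α (suc n) * L n

hankel-shift-b-step : ∀ n → κ n * hankel (shift b) (suc n) ≡ + 2 * ε (suc n) * κ (suc n) * hankel (shift b) n
hankel-shift-b-step n = trans (hankel-step (κ n) leading vanish) (cong (_* hankel (shift b) n) diagonal)
  where
  β : ℕ → ℤ
  β n = α n - ε n * L n
  -- α n + β n x is the remainder of p_n modulo x (1 + x).
  g : ℕ → Seq
  g n r = u n r - α n * e 0 r - β n * e 0 (suc r)
  ring₁ : ∀ s l₁ l₀ x y z w t →
    + 2 * x - (1ℤ + -1ℤ * (-1ℤ * s)) * z - (1ℤ + -1ℤ * (-1ℤ * s) - -1ℤ * (-1ℤ * s) * (l₁ + l₀)) * w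
      ≡ + 2 * (x - y) - (1ℤ + -1ℤ * s) * w - (1ℤ + -1ℤ * s - -1ℤ * s * l₁) * t
        + (+ 2 * y - (1ℤ + s) * z - (1ℤ + s - s * l₀) * w)
        + (1ℤ + -1ℤ * s - -1ℤ * s * l₁) * (w + t)
  ring₁ = solve-∀
  -- The defect is a quadratic divisible by x (1 + x) with leading coefficient `β (suc n)`; x (1 +
  -- x) gives `shift b`.
  g-rec : ∀ n r → g (2 ℕ.+ n) r ≡ g (1 ℕ.+ n) (suc r) + g n r + β (suc n) * shift b r
  g-rec n r = trans
    (ring₁ (ε n) (L (suc n)) (L n) (e (2 ℕ.+ n) r) (e n r) (e 0 r) (e 0 (suc r)) (e 0 (2 ℕ.+ r)))
    (cong (λ x → g (1 ℕ.+ n) (suc r) + g n r + β (suc n) * x) (sym (b≡e₀+shift-e₀ (suc r))))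
  ring₂ : ∀ x y → + 2 * x - (1ℤ + 1ℤ) * x - (1ℤ + 1ℤ - 1ℤ * + 2) * y ≡ 0ℤ
  ring₂ = solve-∀
  ring₃ : ∀ x y → + 2 * x - (1ℤ + -1ℤ * 1ℤ) * y - (1ℤ + -1ℤ * 1ℤ - -1ℤ * 1ℤ * 1ℤ) * (+ 2 * x) ≡ 0ℤ
  ring₃ = solve-∀
  ring₄ : ∀ x y z →
    + 2 * x - (1ℤ + -1ℤ * (-1ℤ * 1ℤ)) * z - (1ℤ + -1ℤ * (-1ℤ * 1ℤ) - -1ℤ * (-1ℤ * 1ℤ) * + 3) * (+ 2 * y)
      - 1ℤ * (+ 2 * y + + 2 * (x - z)) ≡ 0ℤ
  ring₄ = solve-∀
  g₀ : Span (shift b) 0 (g 0)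
  g₀ = null (λ r → ring₂ (e 0 r) (e 0 (suc r)))
  -- Indices start at one: p_1 = x is its own remainder, and p_2 = x^2 + 2 leaves x (1 + x), so the
  -- quotient of p_{n+2} is monic of degree n.
  spans : ∀ n → Span (shift b) n (g (1 ℕ.+ n)) × Leading 1ℤ (shift b) n (g (2 ℕ.+ n))
  spans = span-recurrence (g ∘ suc) (β ∘ (2 ℕ.+_)) (g-rec ∘ suc)
    (null (λ r → ring₃ (e 1 r) (e 0 r)))
    (null (λ r → trans (cong (λ x → g 2 r - 1ℤ * x) (b≡e₀+shift-e₀ (suc r))) (ring₄ (e 2 r) (e 1 r) (e 0 r))))
  span : ∀ n → Span (shift b) n (g n)
  span zero    = g₀
  span (suc n) = span-suc (proj₁ (spans n))
  -- The coefficients are the cross product of the values of p_n, p_{n+1}, p_{n+2} at 0 and at -1, up to sign.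
  v : Seq
  v r = κ n * u (2 ℕ.+ n) r + α n * L (suc n) * u (suc n) r - κ (suc n) * u n r
  ring₅ : ∀ s l₁ l₀ x₂ x₁ x₀ z w f →
    let a₀ = 1ℤ + s
        a₁ = 1ℤ + -1ℤ * s
        a₂ = 1ℤ + -1ℤ * (-1ℤ * s)
        l₂ = l₁ + l₀
        k₀ = a₀ * l₁ + a₁ * l₀
        k₁ = a₁ * l₂ + a₂ * l₁
    in 1ℤ * (k₀ * (x₂ - a₂ * z - (a₂ - -1ℤ * (-1ℤ * s) * l₂) * w - 1ℤ * f)
             + a₀ * l₁ * (x₁ - a₁ * z - (a₁ - -1ℤ * s * l₁) * w))
         + - k₁ * (x₀ - a₀ * z - (a₀ - s * l₀) * w)
       ≡ k₀ * x₂ + a₀ * l₁ * x₁ - k₁ * x₀ - k₀ * f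
  ring₅ = solve-∀
  leading : Leading (κ n) (shift b) n v
  leading = span-resp
    (λ r → ring₅ (ε n) (L (suc n)) (L n) (u (2 ℕ.+ n) r) (u (suc n) r) (u n r)
                 (e 0 r) (e 0 (suc r)) (shift b (n ℕ.+ r)))
    (span-combine 1ℤ (- κ (suc n))
      (span-combine (κ n) (α n * L (suc n)) (proj₂ (spans n)) (proj₁ (spans n)))
      (span n))
  -- For r ≤ n orthogonality removes p_{n+1} and p_{n+2}; the term of p_n alone decides both the
  -- zeros and the diagonal entry.
  v≡ : ∀ {r d} → r ≤ n → e n r ≡ d → v r ≡ + 2 * (-1ℤ * d) * κ (suc n)
  v≡ {r} {d} r≤n enr≡d = trans
    (cong₂ (λ x y → κ n * (+ 2 * x) + α n * L (suc n) * (+ 2 * y) - κ (suc n) * u n r)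
      (e-vanish (ℕₚ.m<n⇒m<1+n (s≤s r≤n))) (e-vanish (s≤s r≤n)))
    (trans (cong (λ x → κ n * (+ 2 * 0ℤ) + α n * L (suc n) * (+ 2 * 0ℤ) - κ (suc n) * (+ 2 * x)) enr≡d)
      (ring₆ (κ n) (α n * L (suc n)) (κ (suc n)) d))
    where
    ring₆ : ∀ x y z d → x * (+ 2 * 0ℤ) + y * (+ 2 * 0ℤ) - z * (+ 2 * d) ≡ + 2 * (-1ℤ * d) * z
    ring₆ = solve-∀
  vanish : ∀ {i} → i < n → v i ≡ 0ℤ
  vanish i<n = v≡ (ℕₚ.<⇒≤ i<n) (e-vanish i<n)
  diagonal : v n ≡ + 2 * ε (suc n) * κ (suc n)
  diagonal = v≡ ℕₚ.≤-refl (e-diagonal n)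

-- `α` alternates between 2 and 0, so exactly one summand survives, and it is the one with the Lucas
-- number of odd index.
κ-closed-form : ∀ n → κ n ≡ + 2 * L (2 ℕ.* ⌊ n /2⌋ ℕ.+ 1)
κ-closed-form n with parity n
... | m , inj₁ refl = begin
  κ (m ℕ.+ m)
    ≡⟨ cong (λ s → (1ℤ + s) * L (suc (m ℕ.+ m)) + (1ℤ + -1ℤ * s) * L (m ℕ.+ m)) (ε-double m) ⟩
  + 2 * L (suc (m ℕ.+ m)) + 0ℤ * L (m ℕ.+ m)
    ≡⟨ ℤₚ.+-identityʳ _ ⟩
  + 2 * L (suc (m ℕ.+ m))
    ≡⟨ cong (λ i → + 2 * L i) (index (ℕₚ.n≡⌊n+n/2⌋ m)) ⟩
  + 2 * L (2 ℕ.* ⌊ m ℕ.+ m /2⌋ ℕ.+ 1) ∎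
  where
  open ≡-Reasoning
  index : ∀ {k} → m ≡ k → suc (m ℕ.+ m) ≡ 2 ℕ.* k ℕ.+ 1
  index refl = trans (ℕₚ.+-comm 1 (m ℕ.+ m)) (cong (λ i → m ℕ.+ i ℕ.+ 1) (sym (ℕₚ.+-identityʳ m)))
... | m , inj₂ refl = begin
  κ (suc (m ℕ.+ m))
    ≡⟨ cong (λ s → (1ℤ + -1ℤ * s) * L (2 ℕ.+ (m ℕ.+ m)) + (1ℤ + -1ℤ * (-1ℤ * s)) * L (suc (m ℕ.+ m))) (ε-double m) ⟩
  0ℤ * L (2 ℕ.+ (m ℕ.+ m)) + + 2 * L (suc (m ℕ.+ m))
    ≡⟨ ℤₚ.+-identityˡ _ ⟩
  + 2 * L (suc (m ℕ.+ m))
    ≡⟨ cong (λ i → + 2 * L i) (index (ℕₚ.n≡⌈n+n/2⌉ m)) ⟩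
  + 2 * L (2 ℕ.* ⌊ suc (m ℕ.+ m) /2⌋ ℕ.+ 1) ∎
  where
  open ≡-Reasoning
  index : ∀ {k} → m ≡ k → suc (m ℕ.+ m) ≡ 2 ℕ.* k ℕ.+ 1
  index refl = trans (ℕₚ.+-comm 1 (m ℕ.+ m)) (cong (λ i → m ℕ.+ i ℕ.+ 1) (sym (ℕₚ.+-identityʳ m)))

-- Closed forms

Lucas>0 : ∀ n → 0 < Lucas n
Lucas>0 zero          = s≤s z≤n
Lucas>0 (suc zero)    = s≤s z≤n
Lucas>0 (suc (suc n)) = ℕₚ.<-≤-trans (Lucas>0 (suc n)) (ℕₚ.m≤m+n _ _)

L-nonZero : ∀ n → ℤ.NonZero (L n)
L-nonZero n = ℕ.>-nonZero (Lucas>0 n)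

κ-nonZero : ∀ n → ℤ.NonZero (κ n)
κ-nonZero n = subst ℤ.NonZero (sym (κ-closed-form n))
  (ℤₚ.i*j≢0 (+ 2) (L (2 ℕ.* ⌊ n /2⌋ ℕ.+ 1)) {{_}} {{L-nonZero (2 ℕ.* ⌊ n /2⌋ ℕ.+ 1)}})

-- The recurrence telescopes: the intermediate weights cancel and w_n / w_0 remains, with w_0 = 2
-- kept on the left to stay in the integers. `δ` is the sign of one step and `σ` the accumulated
-- sign.
ratio-closed-form : ∀ (H w δ σ : ℕ → ℤ) → (∀ n → ℤ.NonZero (w n)) →
  H 0 ≡ 1ℤ → w 0 ≡ + 2 → σ 0 ≡ 1ℤ → (∀ n → σ (suc n) ≡ δ n * σ n) →
  (∀ n → w n * H (suc n) ≡ + 2 * δ n * w (suc n) * H n) →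
  ∀ n → + 2 * H n ≡ σ n * (+ 2) ℤ.^ n * w n
ratio-closed-form H w δ σ w≢0 H₀ w₀ σ₀ σ-step step zero =
  trans (cong (+ 2 *_) H₀) (sym (cong₂ (λ x y → x * 1ℤ * y) σ₀ w₀))
ratio-closed-form H w δ σ w≢0 H₀ w₀ σ₀ σ-step step (suc n) =
  ℤₚ.*-cancelˡ-≡ (w n) _ _ {{w≢0 n}} (begin
    w n * (+ 2 * H (suc n))                          ≡⟨ ring₁ (w n) (H (suc n)) ⟩
    + 2 * (w n * H (suc n))                          ≡⟨ cong (+ 2 *_) (step n) ⟩
    + 2 * (+ 2 * δ n * w (suc n) * H n)              ≡⟨ ring₂ (δ n) (w (suc n)) (H n) ⟩
    + 2 * δ n * w (suc n) * (+ 2 * H n)              ≡⟨ cong (+ 2 * δ n * w (suc n) *_) (ratio-closed-form H w δ σ w≢0 H₀ w₀ σ₀ σ-step step n) ⟩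
    + 2 * δ n * w (suc n) * (σ n * (+ 2) ℤ.^ n * w n) ≡⟨ ring₃ (δ n) (w (suc n)) (σ n) ((+ 2) ℤ.^ n) (w n) ⟩
    w n * (δ n * σ n * (+ 2) ℤ.^ suc n * w (suc n))   ≡⟨ cong (λ x → w n * (x * (+ 2) ℤ.^ suc n * w (suc n))) (σ-step n) ⟨
    w n * (σ (suc n) * (+ 2) ℤ.^ suc n * w (suc n))   ∎)
  where
  open ≡-Reasoning
  ring₁ : ∀ x y → x * (+ 2 * y) ≡ + 2 * (x * y)
  ring₁ = solve-∀
  ring₂ : ∀ d x y → + 2 * (+ 2 * d * x * y) ≡ + 2 * d * x * (+ 2 * y)
  ring₂ = solve-∀
  ring₃ : ∀ d x s p w → + 2 * d * x * (s * p * w) ≡ w * (d * s * (+ 2 * p) * x)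
  ring₃ = solve-∀

ε-triangular : ∀ n → ε (suc n C 2) ≡ ε n * ε (n C 2)
ε-triangular n = begin
  ε (suc n C 2)       ≡⟨ cong ε (nCk+nC[k+1]≡[n+1]C[k+1] n 1) ⟨
  ε (n C 1 ℕ.+ n C 2) ≡⟨ cong (λ i → ε (i ℕ.+ n C 2)) (nC1≡n n) ⟩
  ε (n ℕ.+ n C 2)     ≡⟨ ℤₚ.^-distribˡ-+-* -1ℤ n (n C 2) ⟩
  ε n * ε (n C 2)     ∎
  where open ≡-Reasoning

hankel-b : ∀ n → + 2 * hankel b n ≡ ε (n C 2) * (+ 2) ℤ.^ n * L n
hankel-b = ratio-closed-form (hankel b) L ε (λ n → ε (n C 2)) L-nonZero refl refl refl ε-triangular hankel-b-step

hankel-shift-b : ∀ n → hankel (shift b) n ≡ ε ((n ℕ.+ 1) C 2) * (+ 2) ℤ.^ n * L (2 ℕ.* ⌊ n /2⌋ ℕ.+ 1)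
hankel-shift-b n = ℤₚ.*-cancelˡ-≡ (+ 2) _ _ (begin
  + 2 * hankel (shift b) n
    ≡⟨ ratio-closed-form (hankel (shift b)) κ (ε ∘ suc) (λ n → ε (suc n C 2)) κ-nonZero
         refl refl refl (ε-triangular ∘ suc) hankel-shift-b-step n ⟩
  ε (suc n C 2) * (+ 2) ℤ.^ n * κ n
    ≡⟨ cong₂ (λ i x → ε (i C 2) * (+ 2) ℤ.^ n * x) (ℕₚ.+-comm 1 n) (κ-closed-form n) ⟩
  ε ((n ℕ.+ 1) C 2) * (+ 2) ℤ.^ n * (+ 2 * L (2 ℕ.* ⌊ n /2⌋ ℕ.+ 1))
    ≡⟨ ring₁ (ε ((n ℕ.+ 1) C 2)) ((+ 2) ℤ.^ n) (L (2 ℕ.* ⌊ n /2⌋ ℕ.+ 1)) ⟩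
  + 2 * (ε ((n ℕ.+ 1) C 2) * (+ 2) ℤ.^ n * L (2 ℕ.* ⌊ n /2⌋ ℕ.+ 1)) ∎)
  where
  open ≡-Reasoning
  ring₁ : ∀ x y z → x * y * (+ 2 * z) ≡ + 2 * (x * y * z)
  ring₁ = solve-∀

-- Passage to the rationals and conclusion

fromℤ-* : ∀ i j → fromℤ (i * j) ≡ fromℤ i ℚ.* fromℤ j
fromℤ-* i j = ℚₚ.toℚᵘ-injective (begin
  ℚ.toℚᵘ (fromℤ (i * j))               ≈⟨ ℚₚ.toℚᵘ-fromℚᵘ (mkℚᵘ (i * j) 0) ⟩
  mkℚᵘ i 0 ℚᵘ.* mkℚᵘ j 0               ≈⟨ ℚᵘₚ.*-cong (ℚₚ.toℚᵘ-fromℚᵘ (mkℚᵘ i 0)) (ℚₚ.toℚᵘ-fromℚᵘ (mkℚᵘ j 0)) ⟨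
  ℚ.toℚᵘ (fromℤ i) ℚᵘ.* ℚ.toℚᵘ (fromℤ j) ≈⟨ ℚₚ.toℚᵘ-homo-* (fromℤ i) (fromℤ j) ⟨
  ℚ.toℚᵘ (fromℤ i ℚ.* fromℤ j)         ∎)
  where open ℚᵘₚ.≃-Reasoning

fromℤ-^ : ∀ i n → fromℤ (i ℤ.^ n) ≡ fromℤ i ^ℚ n
fromℤ-^ i zero    = refl
fromℤ-^ i (suc n) = trans (fromℤ-* i (i ℤ.^ n)) (cong (fromℤ i ℚ.*_) (fromℤ-^ i n))

theorem2p2 : ∀ (n : ℕ) →
    (fromℤ (det {n} (λ i j → b (toℕ i ℕ.+ toℕ j)))
    ≡ fromℤ (-1ℤ ℤ.^ (n C 2)) ℚ.* (fromℤ (+ 2) ^ᶻ (+ n ℤ.- 1ℤ)) ℚ.* fromℤ (+ Lucas n))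
    × (det {n} (λ i j → b (toℕ i ℕ.+ toℕ j ℕ.+ 1))
    ≡ (-1ℤ ℤ.^ ((n ℕ.+ 1) C 2)) ℤ.* ((+ 2) ℤ.^ n) ℤ.* (+ Lucas (2 ℕ.* ⌊ n /2⌋ ℕ.+ 1)))
theorem2p2 n = first n , trans
  (det≡hankel n (shift b) _ (λ i j → cong b (ℕₚ.+-comm (toℕ i ℕ.+ toℕ j) 1)))
  (hankel-shift-b n)
  where
  open ≡-Reasoning
  ring₁ : ∀ x y z → x * (+ 2 * y) * z ≡ + 2 * (x * y * z)
  ring₁ = solve-∀
  first : ∀ n → fromℤ (det {n} (λ i j → b (toℕ i ℕ.+ toℕ j)))
    ≡ fromℤ (ε (n C 2)) ℚ.* (fromℤ (+ 2) ^ᶻ (+ n ℤ.- 1ℤ)) ℚ.* fromℤ (L n)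
  -- The exponent is -1 here, and 2^(-1) times L_0 = 2 evaluates to 1.
  first zero    = refl
  first (suc m) = begin
    fromℤ (det {suc m} (λ i j → b (toℕ i ℕ.+ toℕ j)))
      ≡⟨ cong fromℤ (det≡hankel (suc m) b _ (λ _ _ → refl)) ⟩
    fromℤ (hankel b (suc m))
      -- Cancelling the 2 on the left against one factor of 2^(m+1) leaves the exponent m = n - 1.
      ≡⟨ cong fromℤ (ℤₚ.*-cancelˡ-≡ (+ 2) _ _
           (trans (hankel-b (suc m)) (ring₁ (ε (suc m C 2)) ((+ 2) ℤ.^ m) (L (suc m))))) ⟩
    fromℤ (ε (suc m C 2) * (+ 2) ℤ.^ m * L (suc m))
      ≡⟨ fromℤ-* (ε (suc m C 2) * (+ 2) ℤ.^ m) (L (suc m)) ⟩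
    fromℤ (ε (suc m C 2) * (+ 2) ℤ.^ m) ℚ.* fromℤ (L (suc m))
      ≡⟨ cong (ℚ._* fromℤ (L (suc m))) (trans (fromℤ-* (ε (suc m C 2)) ((+ 2) ℤ.^ m))
           (cong (fromℤ (ε (suc m C 2)) ℚ.*_) (fromℤ-^ (+ 2) m))) ⟩
    fromℤ (ε (suc m C 2)) ℚ.* (fromℤ (+ 2) ^ℚ m) ℚ.* fromℤ (L (suc m)) ∎
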